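{- Let $A\subseteq\omega$ be a c.e. infinite set and let $D$ be an effectively given domain with basis $B$ and numbering $\beta$ of the base elements. Then there is a computable onto map $\Gamma:\widehat{\mathcal S}^{(1)}_A\to D$ such that for all $f\in\widehat{\mathcal S}^{(1)}_A$: (1) If $f\in\mathrm{Anf}^{(1)}_A$ then $\Gamma(f)\in B$. (2) If $\beta[\mathrm{range}(f)]$ is directed then $\Gamma(f)\sqsubseteq\bigsqcup\beta[\mathrm{range}(f)]$. (3) If $f\in\mathcal R^{(1)}$ and $\beta[\mathrm{range}(f)]$ is directed then $\Gamma(f)=\bigsqcup\beta[\mathrm{range}(f)]$.
   Context: $\omega$ is the set of natural numbers; $\mathcal F^{(1)}$ is the set of all functions $\omega\to\omega$, $\mathcal R^{(1)}$ the set of total computable ones. $\langle\cdot,\cdot\rangle:\omega^2\to\omega$ is a computable bijection with $\langle x,y\rangle\ge x,y$. $\mathrm{Anf}^{(1)}_A$ is the set of partial functions from $\omega$ to $\omega$ whose domain is either empty or equal to $\{0,\dots,a-1\}$ for some $a\in A$, and $\widehat{\mathcal S}^{(1)}_A=\mathcal F^{(1)}\cup\mathrm{Anf}^{(1)}_A$, ordered by $f\sqsubseteq g$ iff the graph of $f$ is contained in the graph of $g$. A numbering of a set $X$ is a surjection $\omega\to X$. Domain theory: in a poset $(D,\sqsubseteq)$, a directed set is a non-empty subset in which every two elements have an upper bound in the subset. $x\ll y$ means: for every directed $L\subseteq D$ with existing least upper bound, $y\sqsubseteq\bigsqcup L$ implies $x\sqsubseteq u$ for some $u\in L$. $B\subseteq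 D$ is a basis if for each $x\in D$ the set $B_x=\{u\in B:u\ll x\}$ contains a directed subset with least upper bound $x$. A domain is a poset with least element $\bot$ in which all directed sets have least upper bounds and which has a basis. A domain $D$ with countable basis $B$ and numbering $\beta:\omega\to B$ is effectively given if $\{\langle i,j\rangle:\beta_i\ll\beta_j\}$ is c.e. A map $G:D\to D'$ between effectively given domains (numbered bases $\beta,\beta'$) is computable if it is Scott-continuous (monotone and preserving existing least upper bounds of directed sets) and $\{\langle i,j\rangle:\beta'_j\ll G(\beta_i)\}$ is c.e. $\widehat{\mathcal S}^{(1)}_A$ is regarded as an effectively given domain with basis $\mathrm{Anf}^{(1)}_A$ and the following numbering $\alpha^{(1)}$: let $f_A\in\mathcal R^{(1)}$ have range $A$ and fix an effective bijective coding of finite sequences of natural numbers by natural numbers, with length $\mathrm{lth}(a)$ and entries $(a)_j$, $1\le j\le\mathrm{lth}(a)$. Put $\widehat\alpha_{\langle a,b\rangle}(x)=(a)_{x+1}$ if $x<\min\{\mathrm{lth}(a),f_A(b)\}$; $=0$ if $\mathrm{lth}(a)\le x<f_A(b)$; undefined otherwise. $\alpha^{(1)}_0$ is the nowhere defined function and $\alpha^{(1)}_{i+1}=\widehat\alpha_j$ for the least $j$ with $\widehat\alpha_j\notin\{\alpha^{(1)}_0,\dots,\alpha^{(1)}_i\}$. -}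

module Defs where

open import Data.Fin.Base using (Fin; toℕ; fromℕ<)
open import Data.List.Base as List using (List; length)
open import Data.Maybe.Base using (Maybe; just; nothing)
open import Data.Nat.Base using (ℕ; suc; _≤_; _<_)
open import Data.Nat.Properties using (_<?_)
open import Data.Product.Base using (Σ; ∃; ∃₂; _×_; _,_; proj₁; proj₂)
open import Data.Sum.Base using (_⊎_)
open import Data.Vec.Base as Vec using (Vec; []; _∷_)
open import Function.Bundles using (_↔_; Inverse)
open import Level using (_⊔_; 0ℓ) renaming (suc to lsuc)
open import Relation.Binary.Bundles using (Poset)
open import Relation.Binary.Definitions using (Minimum; Monotonic₁)
open import Relation.Binary.PropositionalEquality
  using (_≡_; _≗_; refl; sym; trans)
open import Relation.Nullary.Decidable.Core using (yes; no)
open import Relation.Nullary.Negation.Core using (¬_)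
open import Relation.Unary using (Pred; _∈_; _⊆_; _≐_; _∩_; Empty; Satisfiable)

------------------------------------------------------------------------
-- Partial recursive functions

data Rec : ℕ → Set where
  zer  : Rec 0
  succ : Rec 1
  proj : ∀ {n} → Fin n → Rec n
  comp : ∀ {m n} → Rec m → Vec (Rec n) m → Rec n
  prec : ∀ {n} → Rec n → Rec (suc (suc n)) → Rec (suc n)
  mu   : ∀ {n} → Rec (suc n) → Rec n

infix 4 _[_]⇓_

-- p [ v ]⇓ y : the partial function denoted by p is defined at v, with
-- value y.
data _[_]⇓_ : ∀ {n} → Rec n → Vec ℕ n → ℕ → Set where
  zer⇓  : zer [ [] ]⇓ 0
  succ⇓ : ∀ {x} → succ [ x ∷ [] ]⇓ suc x
  proj⇓ : ∀ {n} {i : Fin n} {v} → proj i [ v ]⇓ Vec.lookup v i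
  comp⇓ : ∀ {m n} {f : Rec m} {gs : Vec (Rec n) m} {v ws y} →
          (∀ i → Vec.lookup gs i [ v ]⇓ Vec.lookup ws i) →
          f [ ws ]⇓ y → comp f gs [ v ]⇓ y
  prec0 : ∀ {n} {f : Rec n} {g v y} →
          f [ v ]⇓ y → prec f g [ 0 ∷ v ]⇓ y
  precS : ∀ {n} {f : Rec n} {g k v r y} →
          prec f g [ k ∷ v ]⇓ r → g [ k ∷ r ∷ v ]⇓ y →
          prec f g [ suc k ∷ v ]⇓ y
  mu⇓   : ∀ {n} {f : Rec (suc n)} {v y} →
          f [ y ∷ v ]⇓ 0 →
          (∀ z → z < y → ∃ λ k → f [ z ∷ v ]⇓ suc k) →
          mu f [ v ]⇓ y

Computable : (ℕ → ℕ) → Set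
Computable f = ∃ λ (p : Rec 1) → ∀ x → p [ x ∷ [] ]⇓ f x

Computable₂ : (ℕ → ℕ → ℕ) → Set
Computable₂ f = ∃ λ (p : Rec 2) → ∀ x y → p [ x ∷ y ∷ [] ]⇓ f x y

rangeOf : (ℕ → ℕ) → Pred ℕ 0ℓ
rangeOf f y = ∃ λ x → f x ≡ y

CE : ∀ {ℓ} → Pred ℕ ℓ → Set ℓ
CE S = Empty S ⊎ ∃ λ f → Computable f × S ≐ rangeOf f

record Pairing : Set where
  field
    bijection  : (ℕ × ℕ) ↔ ℕ

  ⟨_,_⟩ : ℕ → ℕ → ℕ
  ⟨ x , y ⟩ = Inverse.to bijection (x , y)

  unpair : ℕ → ℕ × ℕ
  unpair = Inverse.from bijection

  field
    computable : Computable₂ ⟨_,_⟩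
    ≥-left     : ∀ x y → x ≤ ⟨ x , y ⟩
    ≥-right    : ∀ x y → y ≤ ⟨ x , y ⟩

  -- The set { ⟨ i , j ⟩ ∣ R i j }.
  codes : ∀ {ℓ} → (ℕ → ℕ → Set ℓ) → Pred ℕ ℓ
  codes R n = ∃₂ λ i j → ⟨ i , j ⟩ ≡ n × R i j

record SequenceCoding : Set where
  field
    bijection : ℕ ↔ List ℕ

  sequence : ℕ → List ℕ
  sequence = Inverse.to bijection

  lth : ℕ → ℕ
  lth a = length (sequence a)

  -- entry a j is (a)ⱼ₊₁: Fin counts from 0, whereas the entries of a coded
  -- sequence are numbered from 1.
  entry : ∀ a → Fin (lth a) → ℕ
  entry a = List.lookup (sequence a)

  field
    lth-computable   : Computable lth
    entry-computable : ∃ λ (p : Rec 2) → ∀ a (j : Fin (lth a)) →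
                       p [ a ∷ suc (toℕ j) ∷ [] ]⇓ entry a j

------------------------------------------------------------------------
-- Domains

module _ {c ℓ₁ ℓ₂} (P : Poset c ℓ₁ ℓ₂) where
  open Poset P using (Carrier; _≈_) renaming (_≤_ to _⊑_)

  -- Subsets of a poset need not respect _≈_; directedness and least upper
  -- bounds do not distinguish a subset from its closure under _≈_.
  Subset : Set (lsuc (c ⊔ ℓ₁ ⊔ ℓ₂))
  Subset = Pred Carrier (c ⊔ ℓ₁ ⊔ ℓ₂)

  image : ∀ {a ℓ} {X : Set a} → (X → Carrier) → Pred X ℓ →
          Pred Carrier (a ⊔ ℓ ⊔ ℓ₁)
  image g S d = ∃ λ x → x ∈ S × g x ≈ d

  Directed : ∀ {ℓ} → Pred Carrier ℓ → Set (c ⊔ ℓ₂ ⊔ ℓ)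
  Directed L =
    Satisfiable L ×
    (∀ x y → x ∈ L → y ∈ L → ∃ λ z → z ∈ L × x ⊑ z × y ⊑ z)

  IsLub : ∀ {ℓ} → Pred Carrier ℓ → Carrier → Set (c ⊔ ℓ₂ ⊔ ℓ)
  IsLub L s = (∀ x → x ∈ L → x ⊑ s) × (∀ u → (∀ x → x ∈ L → x ⊑ u) → s ⊑ u)

  WayBelow : Carrier → Carrier → Set (lsuc (c ⊔ ℓ₁ ⊔ ℓ₂))
  WayBelow x y = ∀ (L : Subset) s → Directed L → IsLub L s →
                 y ⊑ s → ∃ λ u → u ∈ L × x ⊑ u

  IsBasis : Subset → Set (lsuc (c ⊔ ℓ₁ ⊔ ℓ₂))
  IsBasis B = ∀ x → ∃ λ (L : Subset) →
              L ⊆ (B ∩ (λ u → WayBelow u x)) × Directed L × IsLub L x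

  IsNumbering : Subset → (ℕ → Carrier) → Set (c ⊔ ℓ₁ ⊔ ℓ₂)
  IsNumbering B β = B ≐ (λ d → ∃ λ i → β i ≈ d)

  record IsEffectivelyGivenDomain (π : Pairing) (B : Subset)
           (β : ℕ → Carrier) : Set (lsuc (c ⊔ ℓ₁ ⊔ ℓ₂)) where
    field
      least     : ∃ λ ⊥ → Minimum _⊑_ ⊥
      complete  : ∀ (L : Subset) → Directed L → ∃ λ s → IsLub L s
      basis     : IsBasis B
      numbering : IsNumbering B β
      ≪-ce      : CE (Pairing.codes π (λ i j → WayBelow (β i) (β j)))

module _ {c ℓ₁ ℓ₂ c′ ℓ₁′ ℓ₂′}
         (P : Poset c ℓ₁ ℓ₂) (Q : Poset c′ ℓ₁′ ℓ₂′) where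
  private
    module P = Poset P
    module Q = Poset Q

  record ScottContinuous (G : P.Carrier → Q.Carrier) :
           Set (lsuc (c ⊔ ℓ₁ ⊔ ℓ₂) ⊔ c′ ⊔ ℓ₁′ ⊔ ℓ₂′) where
    field
      monotone      : Monotonic₁ P._≤_ Q._≤_ G
      preservesLubs : ∀ (L : Subset P) s → Directed P L → IsLub P L s →
                      IsLub Q (image Q G L) (G s)

  record IsComputableMap (π : Pairing) (α : ℕ → P.Carrier) (β : ℕ → Q.Carrier)
           (G : P.Carrier → Q.Carrier) :
           Set (lsuc (c ⊔ ℓ₁ ⊔ ℓ₂ ⊔ c′ ⊔ ℓ₁′ ⊔ ℓ₂′)) where
    field
      continuous : ScottContinuous G
      ce         : CE (Pairing.codes π (λ i j → WayBelow Q (β j) (G (α i))))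

------------------------------------------------------------------------
-- Total functions and functions on initial segments

PartialFun : Set
PartialFun = ℕ → Maybe ℕ

dom : PartialFun → Pred ℕ 0ℓ
dom f x = ∃ λ y → f x ≡ just y

range : PartialFun → Pred ℕ 0ℓ
range f y = ∃ λ x → f x ≡ just y

Total : PartialFun → Set
Total f = ∀ x → x ∈ dom f

TotalComputable : PartialFun → Set
TotalComputable f = ∃ λ g → Computable g × (∀ x → f x ≡ just (g x))

Anf : Pred ℕ 0ℓ → Pred PartialFun 0ℓ
Anf A f = Empty (dom f) ⊎ ∃ λ a → a ∈ A × dom f ≐ (_< a)

Ŝ : Pred ℕ 0ℓ → Poset 0ℓ 0ℓ 0ℓ
Ŝ A = record
  { Carrier        = Σ PartialFun (λ f → Total f ⊎ Anf A f)
  ; _≈_            = λ f g → proj₁ f ≗ proj₁ g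
  ; _≤_            = λ f g → ∀ x y → proj₁ f x ≡ just y → proj₁ g x ≡ just y
  ; isPartialOrder = record
    { isPreorder = record
      { isEquivalence = record
        { refl  = λ _ → refl
        ; sym   = λ p x → sym (p x)
        ; trans = λ p q x → trans (p x) (q x)
        }
      ; reflexive = λ p x _ e → trans (sym (p x)) e
      ; trans     = λ p q x y e → q x y (p x y e)
      }
    ; antisym = λ p q x → antisym′ (p x) (q x)
    }
  }
  where
  antisym′ : ∀ {m n : Maybe ℕ} → (∀ y → m ≡ just y → n ≡ just y) →
             (∀ y → n ≡ just y → m ≡ just y) → m ≡ n
  antisym′ {just y}  {_}       p q = sym (p y refl)
  antisym′ {nothing} {just y}  p q = q y refl
  antisym′ {nothing} {nothing} p q = refl

module _ (π : Pairing) (σ : SequenceCoding) (fA : ℕ → ℕ) where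
  open Pairing π using (unpair)
  open SequenceCoding σ using (lth; entry)

  α̂⟨_,_⟩ : ℕ → ℕ → PartialFun
  α̂⟨ a , b ⟩ x with x <? fA b | x <? lth a
  ... | no  _ | _       = nothing
  ... | yes _ | yes x<l = just (entry a (fromℕ< x<l))
  ... | yes _ | no  _   = just 0

  α̂ : ℕ → PartialFun
  α̂ n = α̂⟨ proj₁ (unpair n) , proj₂ (unpair n) ⟩

  -- The recursion equations of α⁽¹⁾.  They determine α up to extensional
  -- equality; the least j required in step exists when fA has infinite range.
  record IsAlpha (α : ℕ → PartialFun) : Set where
    New : ℕ → ℕ → Set
    New i j = ∀ k → k ≤ i → ¬ (α̂ j ≗ α k)

    field
      start : Empty (dom (α 0))
      step  : ∀ i → ∃ λ j → New i j × (∀ j′ → j′ < j → ¬ New i j′) ×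
                            α (suc i) ≗ α̂ j

module Submission where

-- A program reads f : ω → ω and builds β(u₀) ⊑ β(u₁) ⊑ …, where each β(uₙ)
-- is the least element or way below some β(f(m)) with m < n.
-- It answers one request at a time: once β(i) ≪ β(f(m)) is known for the
-- requested i and m, it waits for a w with β(u) ≪ β(w), β(i) ≪ β(w) and
-- β(w) ≪ β(f(m′)) for some m′, and then replaces u by w.  If β[range(f)] is
-- directed, such a w exists by interpolation, so every request is answered and
-- the chain has the supremum of β[range(f)].  Since uₙ depends on
-- f(0), …, f(n-1) only, Γ(f) is defined as the supremum of the β(uₙ) over all
-- initial segments of dom(f); it is β(uₐ) if dom(f) = {0, …, a-1}.  For
-- surjectivity, every element of D is the supremum of a directed set of basis
-- elements, which some total f enumerates.
--
-- Computability of Γ needs indices of α: α(i+1) is α̂(j) for the i-th number j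
-- (from 0) such that α̂(j) is nonempty and differs from all earlier α̂(k).

open import Defs
open import Axiom.ExcludedMiddle using (ExcludedMiddle)
open import Data.Fin.Base using (Fin; zero; suc; fromℕ<)
open import Data.Fin.Properties using (toℕ-fromℕ<)
open import Data.Maybe.Base using (just; nothing; fromMaybe)
open import Data.Maybe.Properties using (just-injective)
open import Data.Nat.Base
  using (ℕ; zero; suc; pred; _+_; _∸_; _≤_; _<_; z≤n; s≤s; ≢-nonZero; >-nonZero)
open import Data.Nat.InfinitelyOften using (Inf)
open import Data.Nat.Properties
open import Data.Product.Base using (∃; ∃₂; _×_; _,_; proj₁; proj₂)
open import Data.Sum.Base using (_⊎_; inj₁; inj₂; [_,_]′)
open import Data.Vec.Base using (Vec; []; _∷_; lookup; tabulate)
open import Data.Vec.Properties using (lookup∘tabulate)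
open import Function.Base using (id; _∘_)
open import Function.Bundles using (Inverse)
open import Function.Definitions using (Surjective)
open import Level using (Level; Lift; lift; _⊔_; 0ℓ)
open import Relation.Binary.Bundles using (Poset)
open import Relation.Binary.PropositionalEquality
open import Relation.Nullary.Decidable.Core using (yes; no)
open import Relation.Nullary.Negation.Core using (¬_; contradiction)
open import Relation.Unary using (Pred; _∈_; _≐_)

-- Computability of total functions of several variables

Recursive : ∀ {n} → (Vec ℕ n → ℕ) → Set
Recursive {n} f = ∃ λ (p : Rec n) → ∀ v → p [ v ]⇓ f v

-- The loops below are written with this recursor, so that `primrec-recursive` applies to them by
-- unfolding alone.
primrec : ℕ → (ℕ → ℕ → ℕ) → ℕ → ℕ
primrec z s zero    = z
primrec z s (suc n) = s n (primrec z s n)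

module _ {n : ℕ} where

  ext : {f g : Vec ℕ n → ℕ} → f ≗ g → Recursive f → Recursive g
  ext f≗g (p , p⇓) = p , λ v → subst (p [ v ]⇓_) (f≗g v) (p⇓ v)

  var : (i : Fin n) → Recursive (λ v → lookup v i)
  var i = proj i , λ _ → proj⇓

  app₁ : {f : ℕ → ℕ} {g : Vec ℕ n → ℕ} →
         Computable f → Recursive g → Recursive (λ v → f (g v))
  app₁ (p , p⇓) (q , q⇓) = comp p (q ∷ []) , λ v →
    comp⇓ {ws = _ ∷ []} (λ { zero → q⇓ v }) (p⇓ _)

  app₂ : {f : ℕ → ℕ → ℕ} {g h : Vec ℕ n → ℕ} →
         Computable₂ f → Recursive g → Recursive h →
         Recursive (λ v → f (g v) (h v))
  app₂ (p , p⇓) (q , q⇓) (r , r⇓) = comp p (q ∷ r ∷ []) , λ v →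
    comp⇓ {ws = _ ∷ _ ∷ []} (λ { zero → q⇓ v ; (suc zero) → r⇓ v }) (p⇓ _ _)

  lit : (k : ℕ) → Recursive {n} (λ _ → k)
  lit zero    = comp zer [] , λ _ → comp⇓ {ws = []} (λ ()) zer⇓
  lit (suc k) = app₁ (succ , λ _ → succ⇓) (lit k)

  primrec-recursive :
    {z : Vec ℕ n → ℕ} {s : Vec ℕ (2 + n) → ℕ} {g : Vec ℕ n → ℕ} →
    Recursive z → Recursive s → Recursive g →
    Recursive (λ v → primrec (z v) (λ k r → s (k ∷ r ∷ v)) (g v))
  primrec-recursive {z} {s} {g} (p , p⇓) (q , q⇓) (r , r⇓) =
    comp (prec p q) (r ∷ tabulate proj) , λ v → comp⇓ {ws = g v ∷ v}
      (λ { zero    → r⇓ v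
         ; (suc i) → subst (_[ v ]⇓ lookup v i)
                       (sym (lookup∘tabulate proj i)) proj⇓ })
      (run⇓ v (g v))
    where
    run⇓ : ∀ v k → prec p q [ k ∷ v ]⇓ primrec (z v) (λ k r → s (k ∷ r ∷ v)) k
    run⇓ v zero    = prec0 (p⇓ v)
    run⇓ v (suc k) = precS (run⇓ v k) (q⇓ _)

  -- Since `g` is total and does not vanish below `f v`, it takes there the successor values that
  -- `mu⇓` demands.
  mu-recursive : {g : Vec ℕ (suc n) → ℕ} {f : Vec ℕ n → ℕ} → Recursive g →
                 (∀ v → g (f v ∷ v) ≡ 0) →
                 (∀ v z → z < f v → g (z ∷ v) ≢ 0) → Recursive f
  mu-recursive {g} {f} (p , p⇓) root minimal = mu p , λ v →
    mu⇓ (subst (p [ f v ∷ v ]⇓_) (root v) (p⇓ _))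
        (λ z z<f → pred (g (z ∷ v)) ,
           subst (p [ z ∷ v ]⇓_)
             (sym (suc-pred _ {{≢-nonZero (minimal v z z<f)}})) (p⇓ _))

pattern v₀ = zero
pattern v₁ = suc zero
pattern v₂ = suc (suc zero)
pattern v₃ = suc (suc (suc zero))

computable₁ : {f : ℕ → ℕ} → Recursive {1} (λ v → f (lookup v v₀)) → Computable f
computable₁ (p , p⇓) = p , λ x → p⇓ (x ∷ [])

computable₂ : {f : ℕ → ℕ → ℕ} →
              Recursive {2} (λ v → f (lookup v v₀) (lookup v v₁)) → Computable₂ f
computable₂ (p , p⇓) = p , λ x y → p⇓ (x ∷ y ∷ [])

suc-computable : Computable suc
suc-computable = succ , λ _ → succ⇓

+-computable : Computable₂ _+_
+-computable = computable₂ (ext (λ v → lemma (lookup v v₀) (lookup v v₁))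
  (primrec-recursive (var v₁) (app₁ suc-computable (var v₁)) (var v₀)))
  where
  lemma : ∀ m n → primrec n (λ _ → suc) m ≡ m + n
  lemma zero    n = refl
  lemma (suc m) n = cong suc (lemma m n)

pred-computable : Computable pred
pred-computable = computable₁ (ext (λ v → lemma (lookup v v₀))
  (primrec-recursive (lit 0) (var v₀) (var v₀)))
  where
  lemma : ∀ n → primrec 0 (λ k _ → k) n ≡ pred n
  lemma zero    = refl
  lemma (suc n) = refl

∸-computable : Computable₂ _∸_
∸-computable = computable₂ (ext (λ v → lemma (lookup v v₀) (lookup v v₁))
  (primrec-recursive (var v₀) (app₁ pred-computable (var v₁)) (var v₁)))
  where
  lemma : ∀ m n → primrec m (λ _ → pred) n ≡ m ∸ n
  lemma m zero    = refl
  lemma m (suc n) = trans (cong pred (lemma m n)) (pred[m∸n]≡m∸[1+n] m n)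

-- Tests and bounded search by arithmetic

if0_then_else_ : ℕ → ℕ → ℕ → ℕ
if0 c then x else y = primrec x (λ _ _ → y) c

-- Both branches are evaluated, which is harmless for total functions.
if0-recursive : ∀ {n} {c x y : Vec ℕ n → ℕ} →
                Recursive c → Recursive x → Recursive y →
                Recursive (λ v → if0 c v then x v else y v)
if0-recursive (c , c⇓) (x , x⇓) (y , y⇓) =
  comp (proj₁ if0ʳ) (c ∷ x ∷ y ∷ []) , λ v →
    comp⇓ {ws = _ ∷ _ ∷ _ ∷ []}
      (λ { zero → c⇓ v ; (suc zero) → x⇓ v ; (suc (suc zero)) → y⇓ v })
      (proj₂ if0ʳ _)
  where
  if0ʳ : Recursive {3} (λ v → if0 lookup v v₀ then lookup v v₁ else lookup v v₂)
  if0ʳ = primrec-recursive (var v₁) (var (suc v₃)) (var v₀)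

if0-then : ∀ {c x y} → c ≡ 0 → if0 c then x else y ≡ x
if0-then refl = refl

if0-else : ∀ {c x y} → c ≢ 0 → if0 c then x else y ≡ y
if0-else {zero}  c≢0 = contradiction refl c≢0
if0-else {suc c} _   = refl

abstract

  -- A condition is encoded by a number that vanishes exactly when it holds; equality becomes
  -- `dist`, and conjunction becomes addition.
  dist : ℕ → ℕ → ℕ
  dist m n = (m ∸ n) + (n ∸ m)

  ≡⇒dist≡0 : ∀ {m n} → m ≡ n → dist m n ≡ 0
  ≡⇒dist≡0 {m} refl = cong₂ _+_ (n∸n≡0 m) (n∸n≡0 m)

  dist≡0⇒≡ : ∀ {m n} → dist m n ≡ 0 → m ≡ n
  dist≡0⇒≡ {m} {n} d = ≤-antisym (m∸n≡0⇒m≤n (m+n≡0⇒m≡0 (m ∸ n) d))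
                                 (m∸n≡0⇒m≤n (m+n≡0⇒n≡0 (m ∸ n) d))

  dist-computable : Computable₂ dist
  dist-computable = computable₂ (app₂ +-computable
    (app₂ ∸-computable (var v₀) (var v₁)) (app₂ ∸-computable (var v₁) (var v₀)))

dist+≡0⇒ : ∀ {m n k} → dist m n + k ≡ 0 → m ≡ n × k ≡ 0
dist+≡0⇒ {m} {n} d =
  dist≡0⇒≡ (m+n≡0⇒m≡0 (dist m n) d) , m+n≡0⇒n≡0 (dist m n) d

sumBelow : ℕ → (ℕ → ℕ) → ℕ
sumBelow n g = primrec 0 (λ k r → r + g k) n

sumBelow≡0 : ∀ {g} n → (∀ k → k < n → g k ≡ 0) → sumBelow n g ≡ 0
sumBelow≡0 zero    _  = refl
sumBelow≡0 (suc n) g0 =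
  cong₂ _+_ (sumBelow≡0 n λ k k<n → g0 k (m<n⇒m<1+n k<n)) (g0 n ≤-refl)

sumBelow≡0⇒ : ∀ {g} n → sumBelow n g ≡ 0 → ∀ k → k < n → g k ≡ 0
sumBelow≡0⇒ {g} (suc n) s k k<1+n with m<1+n⇒m<n∨m≡n k<1+n
... | inj₁ k<n  = sumBelow≡0⇒ n (m+n≡0⇒m≡0 _ s) k k<n
... | inj₂ refl = m+n≡0⇒n≡0 (sumBelow n g) s

sumBelow-mono : ∀ {g m n} → m ≤ n → sumBelow m g ≤ sumBelow n g
sumBelow-mono {g} {m} m≤n with m≤n⇒∃[o]m+o≡n m≤n
... | o , refl = go o
  where
  go : ∀ o → sumBelow m g ≤ sumBelow (m + o) g
  go zero    rewrite +-identityʳ m = ≤-refl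
  go (suc o) rewrite +-suc m o = ≤-trans (go o) (m≤m+n _ _)

-- With 0 read as truth this is the bounded existential quantifier over zeros of `g`; with 1 read as
-- truth it is the bounded statement that there are none.
noZeroBelow : ℕ → (ℕ → ℕ) → ℕ
noZeroBelow n g = primrec 1 (λ k r → if0 g k then 0 else r) n

noZeroBelow≡0 : ∀ g {n k} → k < n → g k ≡ 0 → noZeroBelow n g ≡ 0
noZeroBelow≡0 g {suc n} k<1+n gk≡0 with g n in eq | m<1+n⇒m<n∨m≡n k<1+n
... | zero  | _         = refl
... | suc _ | inj₁ k<n  = noZeroBelow≡0 g k<n gk≡0
... | suc _ | inj₂ refl = contradiction (trans (sym eq) gk≡0) λ ()

noZeroBelow≡1 : ∀ g n → (∀ k → k < n → g k ≢ 0) → noZeroBelow n g ≡ 1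
noZeroBelow≡1 g zero    _  = refl
noZeroBelow≡1 g (suc n) g≢ = trans (if0-else (g≢ n ≤-refl))
  (noZeroBelow≡1 g n λ k k<n → g≢ k (m<n⇒m<1+n k<n))

-- Computability of the projections of the pairing

module Unpairing (π : Pairing) where
  open Pairing π

  fst snd : ℕ → ℕ
  fst n = proj₁ (unpair n)
  snd n = proj₂ (unpair n)

  unpair-⟨⟩ : ∀ x y → unpair ⟨ x , y ⟩ ≡ (x , y)
  unpair-⟨⟩ x y = Inverse.strictlyInverseʳ bijection (x , y)

  fst-⟨⟩ : ∀ x y → fst ⟨ x , y ⟩ ≡ x
  fst-⟨⟩ x y = cong proj₁ (unpair-⟨⟩ x y)

  snd-⟨⟩ : ∀ x y → snd ⟨ x , y ⟩ ≡ y
  snd-⟨⟩ x y = cong proj₂ (unpair-⟨⟩ x y)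

  ⟨fst,snd⟩ : ∀ n → ⟨ fst n , snd n ⟩ ≡ n
  ⟨fst,snd⟩ n = Inverse.strictlyInverseˡ bijection n

  fst-≤ : ∀ n → fst n ≤ n
  fst-≤ n = subst (fst n ≤_) (⟨fst,snd⟩ n) (≥-left (fst n) (snd n))

  snd-≤ : ∀ n → snd n ≤ n
  snd-≤ n = subst (snd n ≤_) (⟨fst,snd⟩ n) (≥-right (fst n) (snd n))

  -- Search for the least x with ⟨ x , y ⟩ = n for some y; since ⟨ x , y ⟩ ≥ y, only y ≤ n come into
  -- question. Injectivity excludes every x other than `fst n`.
  fst-computable : Computable fst
  fst-computable = computable₁ (mu-recursive
    {g = λ v → noZeroBelow (suc (lookup v v₁))
                 (λ y → dist ⟨ lookup v v₀ , y ⟩ (lookup v v₁))}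
    (primrec-recursive (lit 1)
      (if0-recursive
        (app₂ dist-computable (app₂ computable (var v₂) (var v₀)) (var v₃))
        (lit 0) (var v₁))
      (app₁ suc-computable (var v₁)))
    (λ { (n ∷ []) → noZeroBelow≡0 (λ y → dist ⟨ fst n , y ⟩ n) (s≤s (snd-≤ n))
           (≡⇒dist≡0 (⟨fst,snd⟩ n)) })
    (λ { (n ∷ []) x x<fst z → contradiction
           (trans (sym z) (noZeroBelow≡1 (λ y → dist ⟨ x , y ⟩ n) (suc n) λ y _ d → <⇒≢ x<fst
             (trans (sym (fst-⟨⟩ x y)) (cong fst (dist≡0⇒≡ d))))) λ () }))

  snd-computable : Computable snd
  snd-computable = computable₁ (mu-recursive
    {g = λ v → dist ⟨ fst (lookup v v₁) , lookup v v₀ ⟩ (lookup v v₁)}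
    (app₂ dist-computable
      (app₂ computable (app₁ fst-computable (var v₁)) (var v₀)) (var v₁))
    (λ { (n ∷ []) → ≡⇒dist≡0 (⟨fst,snd⟩ n) })
    (λ { (n ∷ []) y y<snd d → <⇒≢ y<snd
           (trans (sym (snd-⟨⟩ (fst n) y)) (cong snd (dist≡0⇒≡ d))) }))

-- The numbering of the finite functions

module Alpha (π : Pairing) (σ : SequenceCoding) (fA : ℕ → ℕ)
             (fA-computable : Computable fA) where
  open Unpairing π
  open SequenceCoding σ using (lth; entry; lth-computable; entry-computable)

  entry₀ : ℕ → ℕ → ℕ
  entry₀ a k with k <? lth a
  ... | yes k<l = entry a (fromℕ< k<l)
  ... | no  _   = 0

  -- The program for entry may diverge out of range, so it is called inside a
  -- recursion whose length lth a ∸ k is 0 there.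
  entry₀-computable : Computable₂ entry₀
  entry₀-computable =
    comp loop (comp monus (comp lthᵖ (proj v₀ ∷ []) ∷ proj v₁ ∷ []) ∷
               proj v₀ ∷ proj v₁ ∷ []) , λ a k →
      comp⇓ {ws = lth a ∸ k ∷ a ∷ k ∷ []}
        (λ { zero → comp⇓ {ws = lth a ∷ k ∷ []}
                      (λ { zero → comp⇓ {ws = a ∷ []} (λ { zero → proj⇓ }) (lth⇓ a)
                         ; (suc zero) → proj⇓ })
                      (monus⇓ _ _)
           ; (suc zero) → proj⇓
           ; (suc (suc zero)) → proj⇓ })
        (value a k)
    where
    entryᵖ = proj₁ entry-computable
    lthᵖ = proj₁ lth-computable
    lth⇓ = proj₂ lth-computable
    monus = proj₁ ∸-computable
    monus⇓ = proj₂ ∸-computable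

    loop : Rec 3
    loop = prec (comp zer [])
                (comp entryᵖ (proj v₂ ∷ comp succ (proj v₃ ∷ []) ∷ []))

    loop-0 : ∀ a k → loop [ 0 ∷ a ∷ k ∷ [] ]⇓ 0
    loop-0 a k = prec0 (comp⇓ {ws = []} (λ ()) zer⇓)

    loop-suc : ∀ a k (k<l : k < lth a) c →
               loop [ suc c ∷ a ∷ k ∷ [] ]⇓ entry a (fromℕ< k<l)
    loop-suc a k k<l c = precS (previous c)
      (comp⇓ {ws = a ∷ suc k ∷ []}
        (λ { zero → proj⇓
           ; (suc zero) → comp⇓ {ws = k ∷ []} (λ { zero → proj⇓ }) succ⇓ })
        (subst (λ j → entryᵖ [ a ∷ suc j ∷ [] ]⇓ entry a (fromℕ< k<l))
          (toℕ-fromℕ< k<l) (proj₂ entry-computable a (fromℕ< k<l))))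
      where
      -- `precS` requires the recursive call to converge, although the step ignores its value.
      previous : ∀ c → loop [ c ∷ a ∷ k ∷ [] ]⇓
                         primrec 0 (λ _ _ → entry a (fromℕ< k<l)) c
      previous zero    = loop-0 a k
      previous (suc c) = loop-suc a k k<l c

    value : ∀ a k → loop [ lth a ∸ k ∷ a ∷ k ∷ [] ]⇓ entry₀ a k
    value a k with k <? lth a
    ... | yes k<l = subst (λ c → loop [ c ∷ a ∷ k ∷ [] ]⇓ entry a (fromℕ< k<l))
                      (suc-pred _ {{>-nonZero (m<n⇒0<n∸m k<l)}})
                      (loop-suc a k k<l _)
    ... | no  k≮l = subst (λ c → loop [ c ∷ a ∷ k ∷ [] ]⇓ 0)
                      (sym (m≤n⇒m∸n≡0 (≮⇒≥ k≮l))) (loop-0 a k)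

  len : ℕ → ℕ
  len n = fA (snd n)

  value : ℕ → ℕ → ℕ
  value n k = entry₀ (fst n) k

  private
    φ : ℕ → PartialFun
    φ = α̂ π σ fA

  α̂-inside : ∀ n {k} → k < len n → φ n k ≡ just (value n k)
  α̂-inside n {k} k<len with k <? len n | k <? lth (fst n)
  ... | no  k≮ | _     = contradiction k<len k≮
  ... | yes _  | yes _ = refl
  ... | yes _  | no  _ = refl

  α̂-outside : ∀ n {k} → len n ≤ k → φ n k ≡ nothing
  α̂-outside n {k} len≤k with k <? len n | k <? lth (fst n)
  ... | no  _  | _ = refl
  ... | yes k< | _ = contradiction len≤k (<⇒≱ k<)

  dom-α̂ : ∀ n → dom (φ n) ≐ (_< len n)
  dom-α̂ n = inside , λ k<len → _ , α̂-inside n k<len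
    where
    inside : ∀ {k} → ∃ (λ y → φ n k ≡ just y) → k < len n
    inside {k} (y , e) with k <? len n
    ... | yes k< = k<

  -- Deciding equality and novelty of finite functions

  difference : ℕ → ℕ → ℕ
  difference x y = dist (len x) (len y) +
    sumBelow (len x) (λ k → dist (value x k) (value y k))

  difference≡0⇒≗ : ∀ x y → difference x y ≡ 0 → φ x ≗ φ y
  difference≡0⇒≗ x y d k with ≤-<-connex (len x) k
  ... | inj₂ k< = begin
    φ x k            ≡⟨ α̂-inside x k< ⟩
    just (value x k) ≡⟨ cong just (dist≡0⇒≡ (sumBelow≡0⇒ (len x)
                          (proj₂ (dist+≡0⇒ d)) k k<)) ⟩
    just (value y k) ≡⟨ α̂-inside y (subst (k <_) len≡ k<) ⟨
    φ y k            ∎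
    where
    open ≡-Reasoning
    len≡ = proj₁ (dist+≡0⇒ d)
  ... | inj₁ len≤ = trans (α̂-outside x len≤)
                          (sym (α̂-outside y (subst (_≤ k) len≡ len≤)))
    where
    len≡ = proj₁ (dist+≡0⇒ d)

  -- Otherwise `len y` would lie in the domain of `φ x` but not in that of `φ y`.
  len-mono : ∀ x y → φ x ≗ φ y → len x ≤ len y
  len-mono x y x≗y = ≮⇒≥ λ y<x → n≮n (len y)
    (proj₁ (dom-α̂ y) (_ , trans (sym (x≗y (len y))) (α̂-inside x y<x)))

  ≗⇒difference≡0 : ∀ x y → φ x ≗ φ y → difference x y ≡ 0
  ≗⇒difference≡0 x y x≗y = cong₂ _+_
    (≡⇒dist≡0 len≡)
    (sumBelow≡0 (len x) λ k k<x → ≡⇒dist≡0 (just-injective (begin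
        just (value x k) ≡⟨ α̂-inside x k<x ⟨
        φ x k            ≡⟨ x≗y k ⟩
        φ y k            ≡⟨ α̂-inside y (subst (k <_) len≡ k<x) ⟩
        just (value y k) ∎)))
    where
    open ≡-Reasoning
    len≡ : len x ≡ len y
    len≡ = ≤-antisym (len-mono x y x≗y) (len-mono y x (sym ∘ x≗y))

  -- These turn out to be exactly the numbers that the recursion for α selects, described without
  -- reference to α and therefore decidable.
  Fresh : ℕ → Set
  Fresh x = len x ≢ 0 × (∀ y → y < x → ¬ (φ x ≗ φ y))

  fresh : ℕ → ℕ
  fresh x = if0 len x then 0 else noZeroBelow x (difference x)

  Fresh⇒fresh≡1 : ∀ {x} → Fresh x → fresh x ≡ 1
  Fresh⇒fresh≡1 {x} (len≢0 , new) = trans (if0-else len≢0)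
    (noZeroBelow≡1 (difference x) x λ y y<x d → new y y<x (difference≡0⇒≗ x y d))

  fresh≢0⇒Fresh : ∀ {x} → fresh x ≢ 0 → Fresh x
  fresh≢0⇒Fresh {x} f≢0 = len≢0 , λ y y<x x≗y → f≢0
    (trans (if0-else len≢0) (noZeroBelow≡0 (difference x) y<x (≗⇒difference≡0 x y x≗y)))
    where
    len≢0 : len x ≢ 0
    len≢0 l≡0 = f≢0 (if0-then l≡0)

  countFresh : ℕ → ℕ
  countFresh n = sumBelow n fresh

  len-computable : Computable len
  len-computable = computable₁ (app₁ fA-computable (app₁ snd-computable (var v₀)))

  value-computable : Computable₂ value
  value-computable = computable₂
    (app₂ entry₀-computable (app₁ fst-computable (var v₀)) (var v₁))

  difference-computable : Computable₂ difference
  difference-computable = computable₂ (app₂ +-computable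
    (app₂ dist-computable (app₁ len-computable (var v₀)) (app₁ len-computable (var v₁)))
    (primrec-recursive (lit 0)
      (app₂ +-computable (var v₁) (app₂ dist-computable
        (app₂ value-computable (var v₂) (var v₀))
        (app₂ value-computable (var v₃) (var v₀))))
      (app₁ len-computable (var v₀))))

  fresh-computable : Computable fresh
  fresh-computable = computable₁ (if0-recursive (app₁ len-computable (var v₀))
    (lit 0)
    (primrec-recursive (lit 1)
      (if0-recursive (app₂ difference-computable (var v₂) (var v₀)) (lit 0) (var v₁))
      (var v₀)))

  countFresh-computable : Computable countFresh
  countFresh-computable = computable₁ (primrec-recursive (lit 0)
    (app₂ +-computable (var v₁) (app₁ fresh-computable (var v₀))) (var v₀))

  -- Computing the indices selected by the recursion for α

  module Indices (α : ℕ → PartialFun) (isAlpha : IsAlpha π σ fA α) where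
    open IsAlpha isAlpha

    index : ℕ → ℕ
    index i = proj₁ (step i)

    index-new : ∀ i → New i (index i)
    index-new i = proj₁ (proj₂ (step i))

    index-least : ∀ i j → j < index i → ¬ New i j
    index-least i = proj₁ (proj₂ (proj₂ (step i)))

    α≗α̂-index : ∀ i → α (suc i) ≗ φ (index i)
    α≗α̂-index i = proj₂ (proj₂ (proj₂ (step i)))

    α-0 : ∀ k → α 0 k ≡ nothing
    α-0 k with α 0 k in eq
    ... | just y  = contradiction (y , eq) (start k)
    ... | nothing = refl

    len≡0⇒≗α-0 : ∀ j → len j ≡ 0 → φ j ≗ α 0
    len≡0⇒≗α-0 j l≡0 k =
      trans (α̂-outside j (subst (_≤ k) (sym l≡0) z≤n)) (sym (α-0 k))

    -- An earlier y with the same function would also be new at stage i, against leastness; the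
    -- empty function is excluded because it is `α 0`.
    index-Fresh : ∀ i → Fresh (index i)
    index-Fresh i =
      (λ l≡0 → index-new i 0 z≤n (len≡0⇒≗α-0 _ l≡0)) ,
      λ y y<j j≗y → index-least i y y<j λ k k≤i y≗k →
        index-new i k k≤i (λ x → trans (j≗y x) (y≗k x))

    -- What is new at stage i + 1 is new at stage i, which gives ≤. Equality fails because the
    -- function of `index i` is already `α (suc i)`.
    index-< : ∀ i → index i < index (suc i)
    index-< i = ≤∧≢⇒<
      (≮⇒≥ λ lt → index-least i _ lt λ k k≤i →
        index-new (suc i) k (m≤n⇒m≤1+n k≤i))
      (λ eq → index-new (suc i) (suc i) ≤-refl
        (λ x → trans (cong (λ j → φ j x) (sym eq)) (sym (α≗α̂-index i x))))

    index-mono : ∀ {i j} → i ≤ j → index i ≤ index j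
    index-mono {i} {j} i≤j with m≤n⇒m<n∨m≡n i≤j
    ... | inj₂ refl = ≤-refl
    index-mono {i} {suc j} i≤j | inj₁ (s≤s i≤j′) =
      ≤-trans (index-mono i≤j′) (<⇒≤ (index-< j))

    -- The gap before `index i` runs from `start-of i` up to `index i`, exclusively.
    start-of : ℕ → ℕ
    start-of zero    = 0
    start-of (suc i) = suc (index i)

    -- A fresh y in the gap would be new at stage i: it is nonempty, hence not `α 0`, and it exceeds
    -- all earlier indices, hence differs from their functions. This contradicts the leastness of
    -- `index i`.
    between : ∀ i y → start-of i ≤ y → y < index i → fresh y ≡ 0
    between i y s≤y y<j with fresh y in eq
    ... | zero  = refl
    ... | suc _ = contradiction new (index-least i y y<j)
      where
      Fresh-y : Fresh y
      Fresh-y = fresh≢0⇒Fresh (λ f≡0 → contradiction (trans (sym eq) f≡0) λ ())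

      earlier : ∀ i k → start-of i ≤ y → suc k ≤ i → index k < y
      earlier (suc i) k s≤y (s≤s k≤i) = <-≤-trans (s≤s (index-mono k≤i)) s≤y

      new : New i y
      new zero _ y≗0 = proj₁ Fresh-y (n≤0⇒n≡0 (≮⇒≥ λ 0<l →
        contradiction (trans (sym (α̂-inside y 0<l)) (trans (y≗0 0) (α-0 0))) λ ()))
      new (suc k) k<i y≗k = proj₂ Fresh-y (index k) (earlier i k s≤y k<i)
        λ x → trans (y≗k x) (α≗α̂-index k x)

    start-≤ : ∀ i → start-of i ≤ index i
    start-≤ zero    = z≤n
    start-≤ (suc i) = index-< i

    -- Mutual induction: a gap adds nothing to the count, and the index that closes it adds one.
    countFresh-start : ∀ i → countFresh (start-of i) ≡ i
    countFresh-index : ∀ i → countFresh (index i) ≡ i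

    countFresh-start zero    = refl
    countFresh-start (suc i) = trans
      (cong₂ _+_ (countFresh-index i) (Fresh⇒fresh≡1 (index-Fresh i))) (+-comm i 1)

    countFresh-index i = trans
      (cong countFresh (sym (m+[n∸m]≡n (start-≤ i))))
      (trans (constant (index i ∸ start-of i)
               (≤-reflexive (m+[n∸m]≡n (start-≤ i))))
             (countFresh-start i))
      where
      constant : ∀ o → start-of i + o ≤ index i →
                 countFresh (start-of i + o) ≡ countFresh (start-of i)
      constant zero    _  = cong countFresh (+-identityʳ (start-of i))
      constant (suc o) le rewrite +-suc (start-of i) o = trans
        (cong₂ _+_ (constant o (<⇒≤ le)) (between i _ (m≤m+n _ o) le))
        (+-identityʳ _)

    -- `index i` is the least z with more than i fresh numbers among 0, ..., z; truncated
    -- subtraction turns this inequality into a test for zero.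
    index-computable : Computable index
    index-computable = computable₁ (mu-recursive
      {g = λ v → suc (lookup v v₁) ∸ countFresh (suc (lookup v v₀))}
      (app₂ ∸-computable (app₁ suc-computable (var v₁))
        (app₁ countFresh-computable (app₁ suc-computable (var v₀))))
      (λ { (i ∷ []) → m≤n⇒m∸n≡0 (≤-reflexive (sym (countFresh-start (suc i)))) })
      (λ { (i ∷ []) z z<j → m>n⇒m∸n≢0 (s≤s (subst (countFresh (suc z) ≤_)
             (countFresh-index i) (sumBelow-mono z<j))) }))

-- Approximating a sequence of basis elements

module Machine (π : Pairing) (W : ℕ → ℕ) (bot : ℕ) where
  open Pairing π using (⟨_,_⟩) renaming (computable to ⟨⟩-computable)
  open Unpairing π

  infix 4 _⊰_
  -- `W` is to enumerate the codes of ≪ between base elements, so that the stage t is a witness that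
  -- a program can check.
  _⊰_ : ℕ → ℕ → Set
  i ⊰ j = ∃ λ t → W t ≡ ⟨ i , j ⟩

  module _ (g : ℕ → ℕ) where

    -- The request r = ⟨ i , ⟨ t , m ⟩ ⟩ asks for an element above β i; it is
    -- skipped unless W t certifies β i ≪ β (g m).
    inactive : ℕ → ℕ
    inactive r = dist (W (fst (snd r))) ⟨ fst r , g (snd (snd r)) ⟩

    -- Whether e = ⟨ w , ⟨ s₁ , ⟨ s₂ , ⟨ s₃ , m ⟩ ⟩ ⟩ ⟩ fails to certify
    -- β u ≪ β w, β i ≪ β w and β w ≪ β (g m).
    defect : ℕ → ℕ → ℕ → ℕ
    defect e u i =
      dist (W (fst (snd e))) ⟨ u , fst e ⟩ +
      (dist (W (fst (snd (snd e)))) ⟨ i , fst e ⟩ +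
       dist (W (fst (snd (snd (snd e))))) ⟨ fst e , g (snd (snd (snd (snd e)))) ⟩)

    abstract

      -- The state ⟨ u , r ⟩ consists of the current element β u and the current
      -- request r.  Stage n tries the certificate fst n only, so that each
      -- certificate is tried at infinitely many stages.
      next : ℕ → ℕ → ℕ
      next n s =
        if0 inactive (snd s)
        then (if0 defect (fst n) (fst s) (fst (snd s))
              then ⟨ fst (fst n) , suc (snd s) ⟩ else s)
        else ⟨ fst s , suc (snd s) ⟩

      run : ℕ → ℕ
      run = primrec ⟨ bot , 0 ⟩ next

      run-zero : run 0 ≡ ⟨ bot , 0 ⟩
      run-zero = refl

    element request : ℕ → ℕ
    element n = fst (run n)
    request n = snd (run n)

    element-zero : element 0 ≡ bot
    element-zero = trans (cong fst run-zero) (fst-⟨⟩ bot 0)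

    request-zero : request 0 ≡ 0
    request-zero = trans (cong snd run-zero) (snd-⟨⟩ bot 0)

    Active : ℕ → Set
    Active r = W (fst (snd r)) ≡ ⟨ fst r , g (snd (snd r)) ⟩

    record Certificate (e u i : ℕ) : Set where
      constructor certificate
      field
        below₁ : W (fst (snd e)) ≡ ⟨ u , fst e ⟩
        below₂ : W (fst (snd (snd e))) ≡ ⟨ i , fst e ⟩
        above  : W (fst (snd (snd (snd e)))) ≡
                 ⟨ fst e , g (snd (snd (snd (snd e)))) ⟩

    defect≡0⇒ : ∀ {e u i} → defect e u i ≡ 0 → Certificate e u i
    defect≡0⇒ d with dist+≡0⇒ d
    ... | b₁ , d′ with dist+≡0⇒ d′
    ...   | b₂ , d″ = certificate b₁ b₂ (dist≡0⇒≡ d″)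

    ⇒defect≡0 : ∀ {e u i} → Certificate e u i → defect e u i ≡ 0
    ⇒defect≡0 (certificate b₁ b₂ a) =
      cong₂ _+_ (≡⇒dist≡0 b₁) (cong₂ _+_ (≡⇒dist≡0 b₂) (≡⇒dist≡0 a))

    data Stage (n : ℕ) : Set where
      skip    : ¬ Active (request n) →
                element (suc n) ≡ element n → request (suc n) ≡ suc (request n) →
                Stage n
      advance : Active (request n) →
                Certificate (fst n) (element n) (fst (request n)) →
                element (suc n) ≡ fst (fst n) → request (suc n) ≡ suc (request n) →
                Stage n
      wait    : Active (request n) →
                ¬ Certificate (fst n) (element n) (fst (request n)) →
                run (suc n) ≡ run n →
                Stage n

    abstract

      stage : ∀ n → Stage n
      stage n with inactive (request n) ≟ 0 | defect (fst n) (element n) (fst (request n)) ≟ 0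
      ... | no ¬a | _ = skip
        (λ a → ¬a (≡⇒dist≡0 a))
        (trans (cong fst eq) (fst-⟨⟩ _ _)) (trans (cong snd eq) (snd-⟨⟩ _ _))
        where
        eq : run (suc n) ≡ ⟨ element n , suc (request n) ⟩
        eq = if0-else ¬a
      ... | yes a | yes c = advance (dist≡0⇒≡ a) (defect≡0⇒ c)
        (trans (cong fst eq) (fst-⟨⟩ _ _)) (trans (cong snd eq) (snd-⟨⟩ _ _))
        where
        eq : run (suc n) ≡ ⟨ fst (fst n) , suc (request n) ⟩
        eq = trans (if0-then a) (if0-then c)
      ... | yes a | no ¬c = wait (dist≡0⇒≡ a) (λ c → ¬c (⇒defect≡0 c))
        (trans (if0-then a) (if0-else ¬c))

    -- Each stage raises the request by at most one. Hence the request at stage n refers to `g` at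
    -- an argument at most n.
    request-≤ : ∀ n → request n ≤ n
    request-≤ zero    = ≤-reflexive request-zero
    request-≤ (suc n) with stage n
    ... | skip _ _ eq      = ≤-trans (≤-reflexive eq) (s≤s (request-≤ n))
    ... | advance _ _ _ eq = ≤-trans (≤-reflexive eq) (s≤s (request-≤ n))
    ... | wait _ _ eq      =
      ≤-trans (≤-reflexive (cong snd eq)) (m≤n⇒m≤1+n (request-≤ n))

  private
    certificate-index-≤ : ∀ n → snd (snd (snd (snd (fst n)))) ≤ n
    certificate-index-≤ n =
      ≤-trans (snd-≤ _) (≤-trans (snd-≤ _) (≤-trans (snd-≤ _)
        (≤-trans (snd-≤ _) (fst-≤ n))))

  -- The element changes only in an `advance`, whose certificate puts the new one way below a value
  -- of `g`. The bound m < n confines this to arguments already read, as finite inputs demand.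
  element-origin : ∀ g n →
    element g n ≡ bot ⊎ ∃ λ m → m < n × element g n ⊰ g m
  element-origin g zero    = inj₁ (element-zero g)
  element-origin g (suc n) with stage g n
  ... | advance _ c eq _ = inj₂
    (_ , s≤s (certificate-index-≤ n) , _ ,
     trans (Certificate.above c)
       (cong (λ w → ⟨ w , g (snd (snd (snd (snd (fst n))))) ⟩) (sym eq)))
  ... | skip _ eq _ rewrite eq with element-origin g n
  ...   | inj₁ b                = inj₁ b
  ...   | inj₂ (m , m<n , m⊰)   = inj₂ (m , m<n⇒m<1+n m<n , m⊰)
  element-origin g (suc n) | wait _ _ eq rewrite eq with element-origin g n
  ...   | inj₁ b                = inj₁ b
  ...   | inj₂ (m , m<n , m⊰)   = inj₂ (m , m<n⇒m<1+n m<n , m⊰)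

  abstract

    -- Stage n reads `g` in two places, through the certificate and through the request, each time
    -- at an argument at most n.
    run-cong : ∀ {g h} n → (∀ k → k < n → g k ≡ h k) → run g n ≡ run h n
    run-cong zero    _ = refl
    run-cong {g} {h} (suc n) eq
      rewrite sym (run-cong {g} {h} n (λ k k<n → eq k (m<n⇒m<1+n k<n)))
            | eq (snd (snd (snd (snd (fst n))))) (s≤s (certificate-index-≤ n))
            | eq (snd (snd (request g n)))
                 (s≤s (≤-trans (snd-≤ _) (≤-trans (snd-≤ _) (request-≤ g n))))
      = refl

    -- Uniformity in the parameter a allows the machine to run on a finite function given by its
    -- index.
    run-computable : Computable W → {g : ℕ → ℕ → ℕ} → Computable₂ g →
                     Computable₂ (λ a n → run (g a) n)
    run-computable W-computable {g} g-computable = computable₂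
      -- In the step, variables 0, 1, 2 and 3 are the stage, the state, a and n.
      (primrec-recursive (lit ⟨ bot , 0 ⟩)
        (if0-recursive
          (distʳ (app₁ W-computable (fstʳ (sndʳ request′)))
                 (pairʳ (fstʳ request′) (app₂ g-computable (var v₂) (sndʳ (sndʳ request′)))))
          (if0-recursive
            (app₂ +-computable
              (distʳ (app₁ W-computable (fstʳ (sndʳ e))) (pairʳ (fstʳ (var v₁)) w))
              (app₂ +-computable
                (distʳ (app₁ W-computable (fstʳ (sndʳ (sndʳ e))))
                       (pairʳ (fstʳ request′) w))
                (distʳ (app₁ W-computable (fstʳ (sndʳ (sndʳ (sndʳ e)))))
                       (pairʳ w (app₂ g-computable (var v₂)
                                   (sndʳ (sndʳ (sndʳ (sndʳ e)))))))))
            (pairʳ w (app₁ suc-computable request′))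
            (var v₁))
          (pairʳ (fstʳ (var v₁)) (app₁ suc-computable request′)))
        (var v₁))
      where
      fstʳ : ∀ {n} {f : Vec ℕ n → ℕ} → Recursive f → Recursive (λ v → fst (f v))
      fstʳ = app₁ fst-computable

      sndʳ : ∀ {n} {f : Vec ℕ n → ℕ} → Recursive f → Recursive (λ v → snd (f v))
      sndʳ = app₁ snd-computable

      distʳ : ∀ {n} {f h : Vec ℕ n → ℕ} → Recursive f → Recursive h →
              Recursive (λ v → dist (f v) (h v))
      distʳ = app₂ dist-computable

      pairʳ : ∀ {n} {f h : Vec ℕ n → ℕ} → Recursive f → Recursive h →
              Recursive (λ v → ⟨ f v , h v ⟩)
      pairʳ = app₂ ⟨⟩-computable

      request′ : Recursive {4} (λ v → snd (lookup v v₁))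
      request′ = sndʳ (var v₁)

      e : Recursive {4} (λ v → fst (lookup v v₀))
      e = fstʳ (var v₀)

      w : Recursive {4} (λ v → fst (fst (lookup v v₀)))
      w = fstʳ e

-- The domain of total functions and initial segments

module _ (A : Pred ℕ 0ℓ) where
  private
    module Ŝ = Poset (Ŝ A)

  dom-downward : ∀ (f : Ŝ.Carrier) {k m} → k < m → m ∈ dom (proj₁ f) → k ∈ dom (proj₁ f)
  dom-downward (f , inj₁ total)                  k<m m∈ = total _
  dom-downward (f , inj₂ (inj₁ empty))           k<m m∈ = contradiction m∈ (empty _)
  dom-downward (f , inj₂ (inj₂ (a , _ , dom≐))) k<m m∈ =
    proj₂ dom≐ (<-trans k<m (proj₁ dom≐ m∈))

  DefinedBelow : ℕ → Ŝ.Carrier → Set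
  DefinedBelow n f = ∀ m → m < n → m ∈ dom (proj₁ f)

  module _ (em : ExcludedMiddle 0ℓ) where

    -- If no member of L is defined at k, then a member that is defined below k
    -- is already an upper bound of L.
    lub-DefinedBelow : ∀ {L : Subset (Ŝ A)} {s} → Directed (Ŝ A) L → IsLub (Ŝ A) L s →
      ∀ n → DefinedBelow n s → ∃ λ h → h ∈ L × DefinedBelow n h
    lub-DefinedBelow ((h , h∈L) , _) _ zero _ = h , h∈L , λ _ ()
    lub-DefinedBelow {L} {s} L-directed L-lub (suc n) s-def
      with lub-DefinedBelow {L} {s} L-directed L-lub n (λ m m<n → s-def m (m<n⇒m<1+n m<n))
         | em {∃ λ h → h ∈ L × n ∈ dom (proj₁ h)}
    ... | _ | yes (h , h∈L , n∈h) = h , h∈L , below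
      where
      below : DefinedBelow (suc n) h
      below m m<1+n with m<1+n⇒m<n∨m≡n m<1+n
      ... | inj₁ m<n  = dom-downward h m<n n∈h
      ... | inj₂ refl = n∈h
    ... | h , h∈L , h-def | no none =
      contradiction (h , h∈L , n∈h) none
      where
      h-upper : ∀ h′ → h′ ∈ L → h′ Ŝ.≤ h
      -- The argument x lies below n, as `h′` would otherwise be defined at n. So `h` is defined at
      -- x, and a common upper bound forces equal values.
      h-upper h′ h′∈L x y h′x≡y with proj₂ L-directed h h′ h∈L h′∈L
      ... | z , _ , h⊑z , h′⊑z with h-def x (≰⇒> λ n≤x →
              [ (λ n<x → none (h′ , h′∈L , dom-downward h′ n<x (y , h′x≡y)))
              , (λ { refl → none (h′ , h′∈L , y , h′x≡y) }) ]′ (m≤n⇒m<n∨m≡n n≤x))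
      ...   | y′ , hx≡y′ = trans hx≡y′
              (trans (sym (h⊑z x y′ hx≡y′)) (h′⊑z x y h′x≡y))

      n∈h : n ∈ dom (proj₁ h)
      n∈h with s-def n ≤-refl
      ... | y , sn≡y = y , proj₂ L-lub h h-upper n y sn≡y

-- Way-below in effectively given domains

module _ {c ℓ₁ ℓ₂ : Level} (D : Poset c ℓ₁ ℓ₂) where
  open Poset D using (_≈_; module Eq) renaming (_≤_ to _⊑_)

  ≪-⊑-trans : ∀ {x y z} → WayBelow D x y → y ⊑ z → WayBelow D x z
  ≪-⊑-trans x≪y y⊑z L s dir lub z⊑s = x≪y L s dir lub (Poset.trans D y⊑z z⊑s)

  ⊑-≪-trans : ∀ {x y z} → x ⊑ y → WayBelow D y z → WayBelow D x z
  ⊑-≪-trans x⊑y y≪z L s dir lub z⊑s with y≪z L s dir lub z⊑s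
  ... | u , u∈L , y⊑u = u , u∈L , Poset.trans D x⊑y y⊑u

  ≪⇒⊑ : ∀ {B x y} → IsBasis D B → WayBelow D x y → x ⊑ y
  ≪⇒⊑ {y = y} basis x≪y with basis y
  ... | L , _ , dir , lub with x≪y L y dir lub (Poset.refl D)
  ...   | u , u∈L , x⊑u = Poset.trans D x⊑u (proj₁ lub u u∈L)

  minimum-≪ : ∀ {x y} → (∀ z → x ⊑ z) → WayBelow D x y
  minimum-≪ x-min L s ((u , u∈L) , _) _ _ = u , u∈L , x-min u

  -- The directed set of base elements with supremum ⊥ has a member, which lies below ⊥ and so is
  -- least itself.
  minimum-∈-basis : ∀ {π B β} → IsEffectivelyGivenDomain D π B β →
                    ∃ λ i → ∀ d → β i ⊑ d
  minimum-∈-basis egd with IsEffectivelyGivenDomain.least egd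
  ... | bot , bot-min with IsEffectivelyGivenDomain.basis egd bot
  ...   | L , L⊆ , ((u , u∈L) , _) , lub
        with proj₁ (IsEffectivelyGivenDomain.numbering egd) (proj₁ (L⊆ u∈L))
  ...     | i , βi≈u = i , λ d → Poset.trans D (Poset.reflexive D βi≈u)
              (Poset.trans D (proj₁ lub u u∈L) (bot-min d))

-- Interpolation between base elements

module Construction
  {c ℓ₁ ℓ₂ : Level} (D : Poset c ℓ₁ ℓ₂) (π : Pairing) (B : Subset D)
  (β : ℕ → Poset.Carrier D) (egd : IsEffectivelyGivenDomain D π B β)
  (W : ℕ → ℕ) (bot : ℕ)
  (⊰⇒≪ : ∀ {i j} → Machine._⊰_ π W bot i j → WayBelow D (β i) (β j))
  (≪⇒⊰ : ∀ {i j} → WayBelow D (β i) (β j) → Machine._⊰_ π W bot i j)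
  (bot-min : ∀ d → Poset._≤_ D (β bot) d)
  where
  open Poset D using (Carrier; _≈_; module Eq; antisym) renaming
    (_≤_ to _⊑_; refl to ⊑-refl; reflexive to ⊑-reflexive; trans to ⊑-trans)
  open IsEffectivelyGivenDomain egd
  open Pairing π using (⟨_,_⟩; ≥-right)
  open Unpairing π
  open Machine π W bot

  ⊰⇒⊑ : ∀ {i j} → i ⊰ j → β i ⊑ β j
  ⊰⇒⊑ i⊰j = ≪⇒⊑ D basis (⊰⇒≪ i⊰j)

  ⊑-⊰-trans : ∀ {i j k} → β i ⊑ β j → j ⊰ k → i ⊰ k
  ⊑-⊰-trans i⊑j j⊰k = ≪⇒⊰ (⊑-≪-trans D i⊑j (⊰⇒≪ j⊰k))

  ⊰-⊑-trans : ∀ {i j k} → i ⊰ j → β j ⊑ β k → i ⊰ k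
  ⊰-⊑-trans i⊰j j⊑k = ≪⇒⊰ (≪-⊑-trans D (⊰⇒≪ i⊰j) j⊑k)

  bot-⊰ : ∀ {i} → bot ⊰ i
  bot-⊰ = ≪⇒⊰ (minimum-≪ D bot-min)

  -- `complete` speaks of subsets at one fixed universe level, to which `P` is lifted.
  ∈⇒lub : {P : Pred Carrier ℓ₁} → Directed D P → ∃ λ s → IsLub D P s
  ∈⇒lub {P} ((x , x∈P) , dir) with complete (λ d → Lift (c ⊔ ℓ₁ ⊔ ℓ₂) (P d))
      ((x , lift x∈P) , λ y z (lift y∈P) (lift z∈P) →
        let w , w∈P , y⊑w , z⊑w = dir y z y∈P z∈P in w , lift w∈P , y⊑w , z⊑w)
  ... | s , upper , least = s , (λ y y∈P → upper y (lift y∈P)) ,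
                                 λ u u-upper → least u λ y (lift y∈P) → u-upper y y∈P

  -- The basis supplies a directed set of base elements way below `β j` whose supremum is `β j`.
  ⊰-least : ∀ {j d} → (∀ i → i ⊰ j → β i ⊑ d) → β j ⊑ d
  ⊰-least {j} {d} below with basis (β j)
  ... | L , L⊆ , _ , _ , least = least d λ x x∈L →
    let x∈B , x≪βj = L⊆ x∈L
        i , βi≈x   = proj₁ numbering x∈B
    in ⊑-trans (⊑-reflexive (Eq.sym βi≈x))
         (below i (≪⇒⊰ (⊑-≪-trans D (⊑-reflexive βi≈x) x≪βj)))

  -- Both elements lie below members of the directed set that the basis supplies for `β j`; an upper
  -- bound of these members within that set is a base element way below `β j`.
  ⊰-directed : ∀ {i i′ j} → i ⊰ j → i′ ⊰ j →
               ∃ λ k → k ⊰ j × β i ⊑ β k × β i′ ⊑ β k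
  ⊰-directed {i} {i′} {j} i⊰j i′⊰j with basis (β j)
  ... | L , L⊆ , dir , lub
      with ⊰⇒≪ i⊰j L (β j) dir lub ⊑-refl | ⊰⇒≪ i′⊰j L (β j) dir lub ⊑-refl
  ...   | x , x∈L , i⊑x | y , y∈L , i′⊑y with proj₂ dir x y x∈L y∈L
  ...     | z , z∈L , x⊑z , y⊑z with L⊆ z∈L
  ...       | z∈B , z≪βj with proj₁ numbering z∈B
  ...         | k , βk≈z = k , ≪⇒⊰ (⊑-≪-trans D (⊑-reflexive βk≈z) z≪βj) ,
                  ⊑-trans i⊑x (⊑-trans x⊑z (⊑-reflexive (Eq.sym βk≈z))) ,
                  ⊑-trans i′⊑y (⊑-trans y⊑z (⊑-reflexive (Eq.sym βk≈z)))

  -- The base elements two steps of ≪ below `β j` form a directed set with supremum `β j`. Some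
  -- member is therefore above `β i`, and its intermediate element interpolates.
  interpolate : ∀ {i j} → i ⊰ j → ∃ λ k → i ⊰ k × k ⊰ j
  interpolate {i} {j} i⊰j
    with ⊰⇒≪ i⊰j N (β j) N-directed N-lub ⊑-refl
    where
    N : Subset D
    N d = Lift (c ⊔ ℓ₂) (∃₂ λ v v′ → v ⊰ v′ × v′ ⊰ j × β v ≈ d)

    N-directed : Directed D N
    N-directed = (β bot , lift (bot , bot , bot-⊰ , bot-⊰ , Eq.refl)) , joins
      where
      joins : ∀ x y → x ∈ N → y ∈ N → ∃ λ z → z ∈ N × x ⊑ z × y ⊑ z
      joins x y (lift (v , v′ , v⊰v′ , v′⊰j , βv≈x))
                (lift (u , u′ , u⊰u′ , u′⊰j , βu≈y))
        -- The intermediate elements are joined first, so that both lower ones are way below the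
        -- same k and can be joined below it.
        with ⊰-directed v′⊰j u′⊰j
      ... | k , k⊰j , v′⊑k , u′⊑k
        with ⊰-directed (⊰-⊑-trans v⊰v′ v′⊑k) (⊰-⊑-trans u⊰u′ u′⊑k)
      ... | w , w⊰k , v⊑w , u⊑w = β w , lift (w , k , w⊰k , k⊰j , Eq.refl) ,
        ⊑-trans (⊑-reflexive (Eq.sym βv≈x)) v⊑w ,
        ⊑-trans (⊑-reflexive (Eq.sym βu≈y)) u⊑w

    N-lub : IsLub D N (β j)
    N-lub =
      (λ { x (lift (v , v′ , v⊰v′ , v′⊰j , βv≈x)) →
             ⊑-trans (⊑-reflexive (Eq.sym βv≈x)) (⊑-trans (⊰⇒⊑ v⊰v′) (⊰⇒⊑ v′⊰j)) }) ,
      λ d N⊑d → ⊰-least λ v′ v′⊰j → ⊰-least λ v v⊰v′ →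
        N⊑d (β v) (lift (v , v′ , v⊰v′ , v′⊰j , Eq.refl))
  ... | x , lift (v , k , v⊰k , k⊰j , βv≈x) , i⊑x =
    k , ⊑-⊰-trans (⊑-trans i⊑x (⊑-reflexive (Eq.sym βv≈x))) v⊰k , k⊰j

  interpolate₂ : ∀ {i i′ j} → i ⊰ j → i′ ⊰ j → ∃ λ k → i ⊰ k × i′ ⊰ k × k ⊰ j
  interpolate₂ i⊰j i′⊰j with interpolate i⊰j | interpolate i′⊰j
  ... | v , i⊰v , v⊰j | v′ , i′⊰v′ , v′⊰j with ⊰-directed v⊰j v′⊰j
  ...   | k , k⊰j , v⊑k , v′⊑k = k , ⊰-⊑-trans i⊰v v⊑k , ⊰-⊑-trans i′⊰v′ v′⊑k , k⊰j

  -- The chain of approximations and the service of requests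

  module _ (g : ℕ → ℕ) where

    approx : ℕ → Carrier
    approx n = β (element g n)

    approx-suc : ∀ n → approx n ⊑ approx (suc n)
    approx-suc n with stage g n
    ... | skip _ eq _      = ⊑-reflexive (Eq.reflexive (cong β (sym eq)))
    ... | wait _ _ eq      = ⊑-reflexive (Eq.reflexive (cong (β ∘ fst) (sym eq)))
    ... | advance _ c eq _ =
      ⊑-trans (⊰⇒⊑ (_ , Certificate.below₁ c)) (⊑-reflexive (Eq.reflexive (cong β (sym eq))))

    approx-mono : ∀ {m n} → m ≤ n → approx m ⊑ approx n
    approx-mono {m} {n} m≤n with m≤n⇒m<n∨m≡n m≤n
    ... | inj₂ refl = ⊑-refl
    approx-mono {m} {suc n} m≤n | inj₁ (s≤s m≤n′) =
      ⊑-trans (approx-mono m≤n′) (approx-suc n)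

    Served : ℕ → Set ℓ₂
    Served r = ∃ λ n → request g n ≡ suc r × (Active g r → β (fst r) ⊑ approx n)

    -- A stage that waits has rejected its certificate; a stage of either other kind ends the
    -- request.
    steady-or-served : ∀ {n n′} → run g n′ ≡ run g n →
      Served (request g n) ⊎
      (run g (suc n′) ≡ run g n ×
       ¬ (Certificate g (fst n′) (element g n) (fst (request g n))))
    steady-or-served {n} {n′} eq with stage g n′
    ... | wait _ ¬c eq′ = inj₂ (trans eq′ eq , ¬c ∘
            subst (λ s → Certificate g (fst n′) (fst s) (fst (snd s))) (sym eq))
    ... | skip ¬a _ req = inj₁ (suc n′ , trans req (cong (suc ∘ snd) eq) ,
            λ a → contradiction (subst (Active g) (sym (cong snd eq)) a) ¬a)
    ... | advance _ c el req = inj₁ (suc n′ , trans req (cong (suc ∘ snd) eq) ,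
            λ _ → subst₂ (λ r w → β (fst r) ⊑ β w) (cong snd eq) (sym el)
              (⊰⇒⊑ (_ , Certificate.below₂ c)))

    -- Until the request is passed the state is frozen, so a certificate valid at stage n stays
    -- valid.
    run-steady : ∀ n d → Served (request g n) ⊎ run g (n + d) ≡ run g n
    run-steady n zero = inj₂ (cong (run g) (+-identityʳ n))
    run-steady n (suc d) with run-steady n d
    ... | inj₁ served = inj₁ served
    ... | inj₂ eq with steady-or-served eq
    ...   | inj₁ served    = inj₁ served
    ...   | inj₂ (eq′ , _) = inj₂ (trans (cong (run g) (+-suc n d)) eq′)

    module _ (directed : ∀ a b → ∃ λ m → β (g a) ⊑ β (g m) × β (g b) ⊑ β (g m)) where

      -- The current and the requested element are way below values of `g`. Directedness bounds
      -- these values by one `β (g m′)`, and interpolation finds w above both elements and way below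
      -- it.
      certificate-exists : ∀ n → Active g (request g n) →
        ∃ λ e → Certificate g e (element g n) (fst (request g n))
      certificate-exists n active = found (origin (element-origin g n))
        where
        origin : element g n ≡ bot ⊎ (∃ λ m → m < n × element g n ⊰ g m) →
                 ∃ λ m → element g n ⊰ g m
        -- The least element is way below every value; the argument 0 is an arbitrary choice.
        origin (inj₁ eq)          = 0 , subst (_⊰ g 0) (sym eq) bot-⊰
        origin (inj₂ (m , _ , u)) = m , u

        found : (∃ λ m → element g n ⊰ g m) →
                ∃ λ e → Certificate g e (element g n) (fst (request g n))
        found (m , u⊰) with directed m (snd (snd (request g n)))
        ... | m′ , m⊑m′ , r⊑m′
            with interpolate₂ (⊰-⊑-trans u⊰ m⊑m′) (⊰-⊑-trans (_ , active) r⊑m′)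
        ...   | w , (s₁ , W₁) , (s₂ , W₂) , (s₃ , W₃) = e , cert
          where
          e₃ = ⟨ s₃ , m′ ⟩
          e₂ = ⟨ s₂ , e₃ ⟩
          e₁ = ⟨ s₁ , e₂ ⟩
          e = ⟨ w , e₁ ⟩

          cert : Certificate g e (element g n) (fst (request g n))
          cert = certificate
            (trans (cong W s₁-eq) (trans W₁ (cong ⟨ element g n ,_⟩ (sym w-eq))))
            (trans (cong W s₂-eq)
              (trans W₂ (cong ⟨ fst (request g n) ,_⟩ (sym w-eq))))
            (trans (cong W s₃-eq)
              (trans W₃ (cong₂ ⟨_,_⟩ (sym w-eq) (cong g (sym m-eq)))))
            where
            e₁-eq = snd-⟨⟩ w e₁
            e₂-eq = trans (cong snd e₁-eq) (snd-⟨⟩ s₁ e₂)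
            e₃-eq = trans (cong snd e₂-eq) (snd-⟨⟩ s₂ e₃)
            w-eq  = fst-⟨⟩ w e₁
            s₁-eq = trans (cong fst e₁-eq) (fst-⟨⟩ s₁ e₂)
            s₂-eq = trans (cong fst e₂-eq) (fst-⟨⟩ s₂ e₃)
            s₃-eq = trans (cong fst e₃-eq) (fst-⟨⟩ s₃ m′)
            m-eq  = trans (cong snd e₃-eq) (snd-⟨⟩ s₃ m′)

      -- A valid certificate e is tried at stage ⟨ e , n ⟩, which is at least n. If the request is
      -- still open then, the state is that of stage n, and e cannot be rejected.
      serve-active : ∀ n → Active g (request g n) → Served (request g n)
      serve-active n active = tried (certificate-exists n active)
        where
        tried : (∃ λ e → Certificate g e (element g n) (fst (request g n))) →
                Served (request g n)
        tried (e , cert) = go (m≤n⇒∃[o]m+o≡n (≥-right e n))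
          where
          go : (∃ λ d → n + d ≡ ⟨ e , n ⟩) → Served (request g n)
          go (d , n+d≡N) = [ id , at-N ]′ (run-steady n d)
            where
            at-N : run g (n + d) ≡ run g n → Served (request g n)
            at-N eq = [ id , (λ (_ , ¬c) → contradiction
              (subst (λ x → Certificate g x (element g n) (fst (request g n)))
                (sym (trans (cong fst n+d≡N) (fst-⟨⟩ e n))) cert) ¬c) ]′
              (steady-or-served eq)

      serve : ∀ n → Served (request g n)
      serve n = served-at (stage g n)
        where
        served-at : Stage g n → Served (request g n)
        served-at (skip ¬a _ req)   = suc n , req , λ a → contradiction a ¬a
        served-at (advance a _ _ _) = serve-active n a
        served-at (wait a _ _)      = serve-active n a

      request-reached : ∀ r → ∃ λ n → request g n ≡ r
      request-reached zero    = 0 , request-zero g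
      request-reached (suc r) with request-reached r
      ... | n , refl with serve n
      ...   | n′ , req , _ = n′ , req

      -- It suffices to bound each `β i` way below `β (g m)`. A witness t makes the request ⟨ i , ⟨
      -- t , m ⟩ ⟩ active; it is reached and served, which puts some approximation above `β i`.
      approx-exhausts : ∀ m {d} → (∀ n → approx n ⊑ d) → β (g m) ⊑ d
      approx-exhausts m {d} approx⊑d = ⊰-least below
        where
        below : ∀ i → i ⊰ g m → β i ⊑ d
        below i (t , Wt) with request-reached ⟨ i , ⟨ t , m ⟩ ⟩
        ... | n , req with serve n
        ...   | n′ , _ , served = ⊑-trans (⊑-reflexive (Eq.reflexive (cong β (sym i-eq))))
                  (⊑-trans (served active) (approx⊑d n′))
          where
          i-eq = trans (cong fst req) (fst-⟨⟩ i ⟨ t , m ⟩)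
          tm-eq = trans (cong snd req) (snd-⟨⟩ i ⟨ t , m ⟩)
          active : Active g (request g n)
          active = trans (cong W (trans (cong fst tm-eq) (fst-⟨⟩ t m)))
            (trans Wt (cong₂ ⟨_,_⟩ (sym i-eq)
              (cong g (sym (trans (cong snd tm-eq) (snd-⟨⟩ t m))))))

  -- The map Γ and its properties

  module _ (A : Pred ℕ 0ℓ) where
    private
      module Ŝ = Poset (Ŝ A)

    -- The machine takes total inputs. If f is defined below n, the default 0 is not read during the
    -- first n stages.
    totalize : Ŝ.Carrier → ℕ → ℕ
    totalize f x = fromMaybe 0 (proj₁ f x)

    totalize-dom : ∀ f {x y} → proj₁ f x ≡ just y → totalize f x ≡ y
    totalize-dom f = cong (fromMaybe 0)

    approx-cong : ∀ {g h} n → (∀ k → k < n → g k ≡ h k) → approx g n ≈ approx h n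
    approx-cong n eq = Eq.reflexive (cong (β ∘ fst) (run-cong n eq))

    approx-extend : ∀ {f h n} → f Ŝ.≤ h → DefinedBelow A n f →
               approx (totalize f) n ≈ approx (totalize h) n
    approx-extend {f} {h} {n} f≤h f-def = approx-cong n λ k k<n →
      let y , fk≡y = f-def k k<n
      in trans (totalize-dom f fk≡y) (sym (totalize-dom h (f≤h k y fk≡y)))

    Approximation : Ŝ.Carrier → Pred Carrier ℓ₁
    Approximation f d = ∃ λ n → DefinedBelow A n f × approx (totalize f) n ≈ d

    Approximation-directed : ∀ f → Directed D (Approximation f)
    Approximation-directed f = (_ , 0 , (λ _ ()) , Eq.refl) , joins
      where
      joins : ∀ x y → x ∈ Approximation f → y ∈ Approximation f →
              ∃ λ z → z ∈ Approximation f × x ⊑ z × y ⊑ z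
      joins x y (m , m-def , m≈x) (n , n-def , n≈y) with ≤-total m n
      ... | inj₁ m≤n = y , (n , n-def , n≈y) ,
              ⊑-trans (⊑-reflexive (Eq.sym m≈x))
                (⊑-trans (approx-mono _ m≤n) (⊑-reflexive n≈y)) ,
              ⊑-refl
      ... | inj₂ n≤m = x , (m , m-def , m≈x) , ⊑-refl ,
              ⊑-trans (⊑-reflexive (Eq.sym n≈y))
                (⊑-trans (approx-mono _ n≤m) (⊑-reflexive m≈x))

    Γ : Ŝ.Carrier → Carrier
    Γ f = proj₁ (∈⇒lub (Approximation-directed f))

    Γ-lub : ∀ f → IsLub D (Approximation f) (Γ f)
    Γ-lub f = proj₂ (∈⇒lub (Approximation-directed f))

    approx-below-Γ : ∀ f {n} → DefinedBelow A n f → approx (totalize f) n ⊑ Γ f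
    approx-below-Γ f {n} def = proj₁ (Γ-lub f) _ (n , def , Eq.refl)

    Γ-least : ∀ f {d} → (∀ n → DefinedBelow A n f → approx (totalize f) n ⊑ d) →
              Γ f ⊑ d
    Γ-least f below = proj₂ (Γ-lub f) _ λ x (n , def , n≈x) →
      ⊑-trans (⊑-reflexive (Eq.sym n≈x)) (below n def)

    Γ-mono : ∀ {f h} → f Ŝ.≤ h → Γ f ⊑ Γ h
    Γ-mono {f} {h} f≤h = Γ-least f λ n f-def →
      ⊑-trans (⊑-reflexive (approx-extend {f} {h} f≤h f-def))
        (approx-below-Γ h λ m m<n → let y , fm≡y = f-def m m<n in y , f≤h m y fm≡y)

    Γ-cong : ∀ {f h} → f Ŝ.≈ h → Γ f ≈ Γ h
    Γ-cong {f} {h} f≈h = antisym (Γ-mono {f} {h} (Ŝ.reflexive {f} {h} f≈h))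
      (Γ-mono {h} {f} (Ŝ.reflexive {h} {f} (sym ∘ f≈h)))

    -- An approximation to `Γ s` depends on a finite initial segment of s, which by
    -- `lub-DefinedBelow` already belongs to a single member of the directed set.
    Γ-continuous : ExcludedMiddle 0ℓ → ScottContinuous (Ŝ A) D Γ
    Γ-continuous em = record
      { monotone      = λ {f} {h} → Γ-mono {f} {h}
      ; preservesLubs = λ L s L-dir L-lub →
          (λ { x (h , h∈L , Γh≈x) → ⊑-trans (⊑-reflexive (Eq.sym Γh≈x))
                 (Γ-mono {h} {s} (proj₁ L-lub h h∈L)) }) ,
          λ u u-upper → Γ-least s λ n s-def →
            let h , h∈L , h-def = lub-DefinedBelow A em {L} {s} L-dir L-lub n s-def
            in ⊑-trans (⊑-reflexive (Eq.sym (approx-extend {h} {s} (proj₁ L-lub h h∈L) h-def)))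
                 (⊑-trans (approx-below-Γ h h-def) (u-upper (Γ h) (h , h∈L , Eq.refl)))
      }

    -- Only m ≤ n satisfy `DefinedBelow`, so the increasing approximations end with the one at n.
    Γ-finite : ∀ f {n} → dom (proj₁ f) ≐ (_< n) → Γ f ≈ approx (totalize f) n
    Γ-finite f {n} (dom⊆ , ⊆dom) = antisym
      (Γ-least f λ m m-def → approx-mono _ (≮⇒≥ λ n<m →
        n≮n n (dom⊆ (m-def n n<m))))
      (approx-below-Γ f λ m → ⊆dom)

    Γ-Anf : ∀ f → proj₁ f ∈ Anf A → Γ f ∈ B
    Γ-Anf f f∈Anf = proj₂ numbering (_ , Eq.sym (Γ-finite f (proj₂ (bound f∈Anf))))
      where
      bound : proj₁ f ∈ Anf A → ∃ λ n → dom (proj₁ f) ≐ (_< n)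
      bound (inj₁ empty)          = 0 , (λ m∈ → contradiction m∈ (empty _)) , λ ()
      bound (inj₂ (a , _ , dom≐)) = a , dom≐

    -- By `element-origin` each approximation is least or way below a value of f, taken at an
    -- argument where f is defined.
    Γ-⊑-lub : ∀ f {s} → IsLub D (image D β (range (proj₁ f))) s → Γ f ⊑ s
    Γ-⊑-lub f {s} (upper , _) = Γ-least f below
      where
      below : ∀ n → DefinedBelow A n f → approx (totalize f) n ⊑ s
      below n f-def with element-origin (totalize f) n
      ... | inj₁ eq rewrite eq = bot-min s
      ... | inj₂ (m , m<n , el⊰m) with f-def m m<n
      ...   | y , fm≡y = ⊑-trans (⊰⇒⊑ el⊰m)
                (upper _ (y , (m , fm≡y) ,
                  Eq.reflexive (cong β (sym (totalize-dom f fm≡y)))))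

    -- Totality places all approximations below `Γ f`, and directedness makes them exhaust every
    -- value of f.
    Γ-total : ∀ f {s} → Total (proj₁ f) → Directed D (image D β (range (proj₁ f))) →
              IsLub D (image D β (range (proj₁ f))) s → Γ f ≈ s
    Γ-total f {s} total (_ , dir) lub = antisym (Γ-⊑-lub f lub)
      (proj₂ lub _ λ { x (y , (m , fm≡y) , βy≈x) →
        ⊑-trans (⊑-reflexive (Eq.trans (Eq.sym βy≈x)
                  (Eq.reflexive (cong β (sym (totalize-dom f fm≡y))))))
          (approx-exhausts (totalize f) joins m λ n →
            approx-below-Γ f λ k _ → total k) })
      where
      in-range : ∀ m → β (totalize f m) ∈ image D β (range (proj₁ f))
      in-range m with total m
      ... | y , fm≡y = y , (m , fm≡y) ,
              Eq.reflexive (cong β (sym (totalize-dom f fm≡y)))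

      joins : ∀ a b → ∃ λ m → β (totalize f a) ⊑ β (totalize f m) ×
                              β (totalize f b) ⊑ β (totalize f m)
      joins a b with dir _ _ (in-range a) (in-range b)
      ... | z , (y , (m , fm≡y) , βy≈z) , a⊑z , b⊑z =
        m , ⊑-trans a⊑z (⊑-reflexive z≈) , ⊑-trans b⊑z (⊑-reflexive z≈)
        where
        z≈ : z ≈ β (totalize f m)
        z≈ = Eq.trans (Eq.sym βy≈z) (Eq.reflexive (cong β (sym (totalize-dom f fm≡y))))

    -- A total f lists the directed set `L` of base elements with supremum d, and `Γ-total` applies
    -- to it.
    Γ-surjective : ExcludedMiddle (c ⊔ ℓ₁ ⊔ ℓ₂) → Surjective Ŝ._≈_ _≈_ Γ
    Γ-surjective em d with basis d
    ... | L , L⊆ , ((x₀ , x₀∈L) , dir) , upper , least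
        with proj₁ numbering (proj₁ (L⊆ x₀∈L))
    ...   | i₀ , βi₀≈x₀ = f , λ {h} h≈f → Eq.trans (Γ-cong {h} {f} h≈f)
              (Γ-total f {d} (λ _ → _ , refl) range-directed range-lub)
      where
      Indexes : ℕ → Set _
      Indexes i = ∃ λ x → x ∈ L × β i ≈ x

      -- Indices of elements outside `L` are replaced by `i₀`, which names a member of `L`.
      index : ℕ → ℕ
      index i with em {Indexes i}
      ... | yes _ = i
      ... | no  _ = i₀

      f : Ŝ.Carrier
      f = just ∘ index , inj₁ λ _ → _ , refl

      range⊆L : ∀ {y} → y ∈ image D β (range (proj₁ f)) → ∃ λ x → x ∈ L × y ≈ x
      range⊆L (_ , (i , refl) , β≈y) with em {Indexes i}
      ... | yes (x , x∈L , βi≈x) = x , x∈L , Eq.trans (Eq.sym β≈y) βi≈x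
      ... | no  _                = x₀ , x₀∈L , Eq.trans (Eq.sym β≈y) βi₀≈x₀

      L⊆range : ∀ {x} → x ∈ L → x ∈ image D β (range (proj₁ f))
      L⊆range {x} x∈L with proj₁ numbering (proj₁ (L⊆ x∈L))
      ... | i , βi≈x = i , (i , fi≡i) , βi≈x
        where
        fi≡i : just (index i) ≡ just i
        fi≡i with em {Indexes i}
        ... | yes _ = refl
        ... | no ¬p = contradiction (x , x∈L , βi≈x) ¬p

      range-directed : Directed D (image D β (range (proj₁ f)))
      range-directed = (x₀ , L⊆range x₀∈L) , joins
        where
        joins : ∀ y y′ → y ∈ image D β (range (proj₁ f)) →
                y′ ∈ image D β (range (proj₁ f)) →
                ∃ λ z → z ∈ image D β (range (proj₁ f)) × y ⊑ z × y′ ⊑ z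
        joins y y′ y∈ y′∈ with range⊆L y∈ | range⊆L y′∈
        ... | x , x∈L , y≈x | x′ , x′∈L , y′≈x′ with dir x x′ x∈L x′∈L
        ...   | z , z∈L , x⊑z , x′⊑z = z , L⊆range z∈L ,
                  ⊑-trans (⊑-reflexive y≈x) x⊑z , ⊑-trans (⊑-reflexive y′≈x′) x′⊑z

      range-lub : IsLub D (image D β (range (proj₁ f))) d
      range-lub =
        (λ y y∈ → let x , x∈L , y≈x = range⊆L y∈
                  in ⊑-trans (⊑-reflexive y≈x) (upper x x∈L)) ,
        λ u u-upper → least u λ x x∈L → u-upper x (L⊆range x∈L)

-- Enumerating the base elements way below named elements

module _ {c ℓ₁ ℓ₂ : Level} (D : Poset c ℓ₁ ℓ₂) (π : Pairing)
         (β : ℕ → Poset.Carrier D) (W : ℕ → ℕ) (bot : ℕ) where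
  open Poset D using (_≈_; module Eq) renaming (_≤_ to _⊑_; reflexive to ⊑-reflexive)
  open Pairing π using (⟨_,_⟩; codes) renaming (computable to ⟨⟩-computable)
  open Unpairing π
  open Machine π W bot using (_⊰_)

  -- The computable names k reduce the relation to ≪ on the basis; an input codes i, j and a stage
  -- at which `W` may list the pair of j and `k i`.
  ≪-CE : Computable W →
    (∀ {i j} → i ⊰ j → WayBelow D (β i) (β j)) →
    (∀ {i j} → WayBelow D (β i) (β j) → i ⊰ j) →
    (∀ d → β bot ⊑ d) →
    {x : ℕ → Poset.Carrier D} {k : ℕ → ℕ} → Computable k → (∀ i → x i ≈ β (k i)) →
    CE (codes (λ i j → WayBelow D (β j) (x i)))
  ≪-CE W-computable ⊰⇒≪ ≪⇒⊰ bot-min {x} {k} k-computable x≈ =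
    inj₂ (enum , enum-computable , into , onto)
    where
    enum : ℕ → ℕ
    -- A failed check yields ⟨ 0 , bot ⟩, which belongs to the set because `β bot` is way below
    -- everything.
    enum n = if0 dist (W (snd (snd n))) ⟨ fst (snd n) , k (fst n) ⟩
             then ⟨ fst n , fst (snd n) ⟩ else ⟨ 0 , bot ⟩

    enum-computable : Computable enum
    enum-computable = computable₁ (if0-recursive
      (app₂ dist-computable
        (app₁ W-computable (app₁ snd-computable (app₁ snd-computable (var v₀))))
        (app₂ ⟨⟩-computable
          (app₁ fst-computable (app₁ snd-computable (var v₀)))
          (app₁ k-computable (app₁ fst-computable (var v₀)))))
      (app₂ ⟨⟩-computable (app₁ fst-computable (var v₀))
        (app₁ fst-computable (app₁ snd-computable (var v₀))))
      (lit ⟨ 0 , bot ⟩))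

    into : ∀ {n} → codes (λ i j → WayBelow D (β j) (x i)) n → rangeOf enum n
    into (i , j , refl , j≪x)
      with ≪⇒⊰ {j} {k i} (≪-⊑-trans D j≪x (⊑-reflexive (x≈ i)))
    ... | t , Wt = n , trans (if0-then (≡⇒dist≡0 (trans (cong W t-eq)
                (trans Wt (cong₂ ⟨_,_⟩ (sym j-eq) (cong k (sym i-eq)))))))
              (cong₂ ⟨_,_⟩ i-eq j-eq)
      where
      n = ⟨ i , ⟨ j , t ⟩ ⟩
      i-eq = fst-⟨⟩ i ⟨ j , t ⟩
      j-eq = trans (cong fst (snd-⟨⟩ i ⟨ j , t ⟩)) (fst-⟨⟩ j t)
      t-eq = trans (cong snd (snd-⟨⟩ i ⟨ j , t ⟩)) (snd-⟨⟩ j t)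

    onto : ∀ {n} → rangeOf enum n → codes (λ i j → WayBelow D (β j) (x i)) n
    onto (n , refl) with dist (W (snd (snd n))) ⟨ fst (snd n) , k (fst n) ⟩ in eq
    ... | zero  = fst n , fst (snd n) , refl ,
          ≪-⊑-trans D (⊰⇒≪ (snd (snd n) , dist≡0⇒≡ eq)) (⊑-reflexive (Eq.sym (x≈ _)))
    ... | suc _ = 0 , bot , refl , minimum-≪ D bot-min

theorem9p9 : (∀ (ℓ : Level) → ExcludedMiddle ℓ) →
    ∀ (π : Pairing) (σ : SequenceCoding)
    (A : Pred ℕ 0ℓ) → CE A → Inf A →
    ∀ (fA : ℕ → ℕ) → Computable fA → A ≐ rangeOf fA →
    ∀ (α : ℕ → Poset.Carrier (Ŝ A)) → IsAlpha π σ fA (proj₁ ∘ α) →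
    ∀ {c ℓ₁ ℓ₂ : Level} (D : Poset c ℓ₁ ℓ₂) (B : Subset D)
    (β : ℕ → Poset.Carrier D) → IsEffectivelyGivenDomain D π B β →
    ∃ λ (Γ : Poset.Carrier (Ŝ A) → Poset.Carrier D) →
    IsComputableMap (Ŝ A) D π α β Γ ×
    Surjective (Poset._≈_ (Ŝ A)) (Poset._≈_ D) Γ ×
    (∀ (f : Poset.Carrier (Ŝ A)) →
    let β[range-f] = image D β (range (proj₁ f)) in
    (proj₁ f ∈ Anf A → Γ f ∈ B) ×
    (Directed D β[range-f] →
    ∃ λ s → IsLub D β[range-f] s × Poset._≤_ D (Γ f) s) ×
    (TotalComputable (proj₁ f) → Directed D β[range-f] →
    ∃ λ s → IsLub D β[range-f] s × Poset._≈_ D (Γ f) s))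
theorem9p9 em π σ A _ _ fA fA-computable _ α isAlpha {c} {ℓ₁} {ℓ₂} D B β egd
  with minimum-∈-basis D egd | IsEffectivelyGivenDomain.≪-ce egd
-- The relation ≪ on the basis is not empty, since `β bot` is way below itself.
... | bot , bot-min | inj₁ empty =
  contradiction (bot , bot , refl , minimum-≪ D bot-min) (empty _)
... | bot , bot-min | inj₂ (W , W-computable , codes⊆ , ⊆codes) =
  Γ A ,
  record
    { continuous = Γ-continuous A (em 0ℓ)
    ; ce         = ≪-CE D π β W bot W-computable ⊰⇒≪ ≪⇒⊰ bot-min
                     name-computable Γα≈
    } ,
  Γ-surjective A (em (c ⊔ ℓ₁ ⊔ ℓ₂)) ,
  λ f → Γ-Anf A f ,
    (λ dir → let s , lub = ∈⇒lub dir in s , lub , Γ-⊑-lub A f lub) ,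
    (λ (g , _ , f≡g) dir → let s , lub = ∈⇒lub dir in
      s , lub , Γ-total A f (λ x → g x , f≡g x) dir lub)
  where
  open Pairing π using (⟨_,_⟩)
  open Unpairing π
  open Machine π W bot using (_⊰_; element; element-zero; run-computable)
  open Alpha π σ fA fA-computable
  open Indices (proj₁ ∘ α) isAlpha

  ⊰⇒≪ : ∀ {i j} → i ⊰ j → WayBelow D (β i) (β j)
  ⊰⇒≪ {i} {j} (t , Wt) with ⊆codes (t , Wt)
  ... | i′ , j′ , eq , i′≪j′ = subst₂ (λ x y → WayBelow D (β x) (β y))
    (trans (sym (fst-⟨⟩ i′ j′)) (trans (cong fst eq) (fst-⟨⟩ i j)))
    (trans (sym (snd-⟨⟩ i′ j′)) (trans (cong snd eq) (snd-⟨⟩ i j))) i′≪j′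

  ≪⇒⊰ : ∀ {i j} → WayBelow D (β i) (β j) → i ⊰ j
  ≪⇒⊰ i≪j = codes⊆ (_ , _ , refl , i≪j)

  open Construction D π B β egd W bot ⊰⇒≪ ≪⇒⊰ bot-min

  -- A base index of `Γ (α i)`: the machine runs for as many stages as the finite function is long.
  -- The recursor only separates the empty function `α 0` from the others.
  name : ℕ → ℕ
  name = primrec bot (λ i _ → element (value (index i)) (len (index i)))

  name-computable : Computable name
  name-computable = computable₁ (primrec-recursive (lit bot)
    (app₁ fst-computable (app₂ (run-computable W-computable value-computable)
      (app₁ index-computable (var v₀))
      (app₁ len-computable (app₁ index-computable (var v₀)))))
    (var v₀))

  Γα≈ : ∀ i → Poset._≈_ D (Γ A (α i)) (β (name i))
  Γα≈ zero = Poset.antisym D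
    (Γ-least A (α 0) λ
      -- The empty function is undefined at 0, so only the initial approximation remains.
      { zero    _   → Poset.reflexive D (Poset.Eq.reflexive D (cong β (element-zero _)))
      ; (suc n) def → contradiction (def 0 (s≤s z≤n)) (IsAlpha.start isAlpha 0) })
    (bot-min _)
  Γα≈ (suc i) = Poset.Eq.trans D (Γ-finite A (α (suc i)) dom≐)
    (approx-cong A _ λ k k<len → totalize-dom A (α (suc i))
      (trans (α≗α̂-index i k) (α̂-inside (index i) k<len)))
    where
    dom≐ : dom (proj₁ (α (suc i))) ≐ (_< len (index i))
    dom≐ = (λ (y , e) → proj₁ (dom-α̂ (index i)) (y , trans (sym (α≗α̂-index i _)) e)) ,
           (λ k< → let y , e = proj₂ (dom-α̂ (index i)) k< in
                   y , trans (α≗α̂-index i _) e)
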